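{- Let $1\le i<j\le N$. If $n_i$ is not forward-connected to $n_j$, then there exist a node $n_{i'}$ with $0\le i'<i$, an integer $p\ge 0$ and indices $i<k_1<k_2<\dots<k_p<j$ such that $$C^{\mathbf{A}}_{k_1}+C^{\mathbf{A}}_{k_2}+\cdots+C^{\mathbf{A}}_{k_p}+C^{\mathbf{A}}_j=X_j^N-X_{i'}^N .$$ (When $p=0$ the left-hand side is just $C^{\mathbf{A}}_j$.)
   Context: Let $G$ be a finite tree (connected acyclic simple graph) with nodes $n_0,n_1,\dots,n_N$, where $n_0$ is a terminal node (degree one) and the nodes are indexed so that along the path in $G$ from $n_0$ to any node $n_i$ the successively encountered node indices strictly increase. Node $n_i$ is forward-adjacent to $n_k$ if $n_i$ and $n_k$ are adjacent and $i<k$. Node $n_i$ is forward-connected to $n_j$ ($i<j$ necessarily) if there is a sequence of nodes $n_i=n_{l_0},n_{l_1},\dots,n_{l_m}=n_j$ with $m\ge 1$ in which each $n_{l_t}$ is forward-adjacent to $n_{l_{t+1}}$. The forward adjacency matrix $\mathbf{A}$ of $G$ is the $N\times N$ matrix, with rows and columns indexed by $1,\dots,N$, given by $\mathbf{A}(i,j)=1$ if $i=j$, $\mathbf{A}(i,j)=-1$ if $n_i$ is forward-adjacent to $n_j$, and $\mathbf{A}(i,j)=0$ otherwise. $C^{\mathbf{Q}}_j$ denotes the $j$-th column of a matrix $\mathbf{Q}$. For $1\le i\le N$, $X_i^N$ is the $N$-dimensional column vector with $1$ as its $i$-th entry and zeros elsewhere; $X_0^N$ is the $N$-dimensional zero vector.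 -}

module Defs where

open import Level using (0ℓ)
open import Data.Bool using (if_then_else_)
open import Data.Fin using (Fin; zero; suc; _<_)
open import Data.Fin.Properties using (_≟_; _<?_)
open import Data.Integer as ℤ using (ℤ; 0ℤ; 1ℤ; -1ℤ)
open import Data.List using (List; []; _∷_; length; filter; allFin; foldr; map)
open import Data.List.Relation.Unary.Linked using (Linked)
open import Data.List.Relation.Unary.Unique.Propositional using (Unique)
open import Data.Nat as ℕ using (ℕ; suc)
open import Data.Product using (Σ; _×_)
open import Data.Vec.Functional using (Vector; zipWith; replicate)
open import Relation.Binary using (Rel; Symmetric; Irreflexive; Decidable)
open import Relation.Binary.Construct.Closure.ReflexiveTransitive using (Star; ε; _◅_)
open import Relation.Binary.Construct.Closure.Transitive using (TransClosure)
open import Relation.Binary.PropositionalEquality using (_≡_)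
open import Relation.Nullary using (¬_; does)
open import Relation.Nullary.Decidable using (_×-dec_)

record SimpleGraph (n : ℕ) : Set₁ where
  field
    Adj         : Rel (Fin n) 0ℓ
    adj?        : Decidable Adj
    symmetric   : Symmetric Adj
    irreflexive : Irreflexive _≡_ Adj

module _ {n : ℕ} (G : SimpleGraph n) where
  open SimpleGraph G

  degree : Fin n → ℕ
  degree u = length (filter (adj? u) (allFin n))

  Terminal : Fin n → Set
  Terminal u = degree u ≡ 1

  Walk : Rel (Fin n) 0ℓ
  Walk = Star Adj

  vertices : ∀ {u v} → Walk u v → List (Fin n)
  vertices {u} ε       = u ∷ []
  vertices {u} (_ ◅ w) = u ∷ vertices w

  IsPath : ∀ {u v} → Walk u v → Set
  IsPath w = Unique (vertices w)

  Connected : Set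
  Connected = ∀ u v → Σ (Walk u v) IsPath

  -- A cycle is a path on at least three vertices whose ends are adjacent.
  record Cycle : Set where
    field
      {start end} : Fin n
      walk        : Walk start end
      isPath      : IsPath walk
      long        : 3 ℕ.≤ length (vertices walk)
      closing     : Adj end start

  Acyclic : Set
  Acyclic = ¬ Cycle

  IsTree : Set
  IsTree = Connected × Acyclic

  ForwardAdjacent : Rel (Fin n) 0ℓ
  ForwardAdjacent u v = Adj u v × u < v

  forwardAdjacent? : Decidable ForwardAdjacent
  forwardAdjacent? u v = adj? u v ×-dec u <? v

  ForwardConnected : Rel (Fin n) 0ℓ
  ForwardConnected = TransClosure ForwardAdjacent

IncreasingFromRoot : ∀ {N} → SimpleGraph (suc N) → Set
IncreasingFromRoot G =
  ∀ i (w : Walk G zero i) → IsPath G w → Linked _<_ (vertices G w)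

-- Nodes n₀, …, n_N are the elements of Fin (suc N).  Rows, columns and vector
-- entries, numbered 1, …, N on paper, are indexed by Fin N: the index i : Fin N
-- belongs to the node suc i.

Matrix : ℕ → Set
Matrix N = Fin N → Fin N → ℤ

forwardAdjacency : ∀ {N} → SimpleGraph (suc N) → Matrix N
forwardAdjacency G i j =
  if does (i ≟ j) then 1ℤ
  else if does (forwardAdjacent? G (suc i) (suc j)) then -1ℤ
  else 0ℤ

column : ∀ {N} → Matrix N → Fin N → Vector ℤ N
column Q j = λ i → Q i j

-- Takes a node: X zero is the zero vector, X (suc i) the unit vector at i.
X : ∀ {N} → Fin (suc N) → Vector ℤ N
X zero    = replicate _ 0ℤ
X (suc i) = λ r → if does (r ≟ i) then 1ℤ else 0ℤ

infixl 6 _⊕_ _⊖_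

_⊕_ : ∀ {N} → Vector ℤ N → Vector ℤ N → Vector ℤ N
_⊕_ = zipWith ℤ._+_

_⊖_ : ∀ {N} → Vector ℤ N → Vector ℤ N → Vector ℤ N
_⊖_ = zipWith ℤ._-_

-- columnSum Q (k₁ ∷ … ∷ kₚ ∷ []) j  is  C_{k₁} + … + C_{kₚ} + C_j.
columnSum : ∀ {N} → Matrix N → List (Fin N) → Fin N → Vector ℤ N
columnSum Q ks j = foldr _⊕_ (column Q j) (map (column Q) ks)

{-# OPTIONS --safe #-}
-- In an increasingly indexed tree every node other than n₀ has exactly one
-- forward-adjacent predecessor: two predecessors u ≠ v of w could be joined
-- through n₀ by a path among the nodes below w, and w would close it to a cycle.
-- So C_k = X_k − X_u for the predecessor u of n_k, and the sum telescopes along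
-- the part of the path from n₀ to n_j whose nodes lie above n_i; i′ is the last
-- node of that path below n_i, since n_i itself is not on it.
module Submission where

open import Defs
open import Data.Empty using (⊥-elim)
open import Data.Fin using (Fin; zero; suc; _<_)
open import Data.Fin.Properties using (_≟_; <-cmp; <-trans; <-irrefl)
open import Data.Bool using (if_then_else_)
open import Data.Integer as ℤ using (0ℤ; 1ℤ)
open import Data.Integer.Tactic.RingSolver using (solve-∀)
open import Data.List using (List; []; _∷_; _++_; length)
open import Data.List.Membership.Propositional using (_∈_)
open import Data.List.Relation.Unary.All as All using (All; []; _∷_)
open import Data.List.Relation.Unary.All.Properties using (¬Any⇒All¬)
open import Data.List.Relation.Unary.AllPairs using ([]; _∷_)
open import Data.List.Relation.Unary.Any using (here; there)
open import Data.List.Relation.Unary.Linked using (Linked; [-]; _∷_)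
open import Data.Nat as ℕ using (ℕ; suc; z≤n; s≤s; s<s⁻¹)
open import Data.Product using (∃-syntax; _×_; _,_; proj₁; proj₂)
open import Relation.Binary using (Rel; tri<; tri≈; tri>)
open import Relation.Binary.Construct.Closure.ReflexiveTransitive
  using (Star; ε; _◅_; _◅◅_; reverse)
open import Relation.Binary.Construct.Closure.Transitive
  using (TransClosure; [_]; _∷_)
open import Relation.Binary.PropositionalEquality
  using (_≡_; _≢_; _≗_; refl; sym; trans; cong₂)
open import Relation.Nullary using (¬_; yes; no; does)
open import Relation.Nullary.Decidable using (decidable-stable; dec-true; dec-false)
open import Relation.Unary using (Pred)
open import Level using (0ℓ)

◅⇒TransClosure : ∀ {A : Set} {R : Rel A 0ℓ} {x y z} →
                 R x y → Star R y z → TransClosure R x z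
◅⇒TransClosure r ε       = [ r ]
◅⇒TransClosure r (s ◅ p) = r ∷ ◅⇒TransClosure s p

module _ {n} (G : SimpleGraph n) where
  open SimpleGraph G
  open import Data.List.Membership.DecPropositional (_≟_ {n}) using (_∈?_)

  module _ (P : Pred (Fin n) 0ℓ) where

    AdjWithin : Rel (Fin n) 0ℓ
    AdjWithin u v = Adj u v × P u × P v

    AdjWithin-sym : ∀ {u v} → AdjWithin u v → AdjWithin v u
    AdjWithin-sym (a , pu , pv) = symmetric a , pv , pu

    PathWithin : Rel (Fin n) 0ℓ
    PathWithin u v = ∃[ w ] (IsPath G {u} {v} w × All P (vertices G w))

    pathSuffix : ∀ {u v x} (w : Walk G u v) → IsPath G w →
                 All P (vertices G w) → x ∈ vertices G w → PathWithin x v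
    pathSuffix ε       path       all       (here refl) = ε , path , all
    pathSuffix (a ◅ w) path       all       (here refl) = a ◅ w , path , all
    pathSuffix (a ◅ w) (_ ∷ path) (_ ∷ all) (there x∈w) = pathSuffix w path all x∈w

    eraseLoops : ∀ {u v} → P u → Star AdjWithin u v → PathWithin u v
    eraseLoops pu ε = ε , [] ∷ [] , pu ∷ []
    eraseLoops {u} pu ((a , _ , py) ◅ s) with eraseLoops py s
    ... | w , path , all with u ∈? vertices G w
    ...   | yes u∈w = pathSuffix w path all u∈w
    ...   | no  u∉w = a ◅ w , ¬Any⇒All¬ _ u∉w ∷ path , pu ∷ all

  vertices-nonempty : ∀ {u v} (w : Walk G u v) → 1 ℕ.≤ length (vertices G w)
  vertices-nonempty ε       = s≤s z≤n
  vertices-nonempty (_ ◅ _) = s≤s z≤n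

  closedPath⇒Cycle : ∀ {u v w} (p : Walk G u v) → IsPath G p → u ≢ v →
                     All (w ≢_) (vertices G p) → Adj u w → Adj v w → Cycle G
  closedPath⇒Cycle ε _ u≢v _ _ _ = ⊥-elim (u≢v refl)
  closedPath⇒Cycle (a ◅ p) path _ w∉p uw vw = record
    { walk    = symmetric uw ◅ a ◅ p
    ; isPath  = w∉p ∷ path
    ; long    = s≤s (s≤s (vertices-nonempty p))
    ; closing = vw
    }

  linked⇒forward : ∀ {u v} (w : Walk G u v) → Linked _<_ (vertices G w) →
                   Star (ForwardAdjacent G) u v
  linked⇒forward ε           _       = ε
  linked⇒forward (a ◅ ε)     (l ∷ _) = (a , l) ◅ ε
  linked⇒forward (a ◅ b ◅ w) (l ∷ r) = (a , l) ◅ linked⇒forward (b ◅ w) r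

  forward-below : ∀ {u v w} → Star (ForwardAdjacent G) u v → v < w →
                  u < w × Star (AdjWithin (_< w)) u v
  forward-below ε v<w = v<w , ε
  forward-below ((a , x<y) ◅ s) v<w with forward-below s v<w
  ... | y<w , s′ = <-trans x<y y<w , (a , <-trans x<y y<w , y<w) ◅ s′

  predecessor-unique : Acyclic G → ∀ {r u v w} →
    Star (ForwardAdjacent G) r u → Star (ForwardAdjacent G) r v →
    ForwardAdjacent G u w → ForwardAdjacent G v w → u ≡ v
  predecessor-unique acyclic {u = u} {v} {w} ru rv (uw , u<w) (vw , v<w) =
    decidable-stable (u ≟ v) λ u≢v →
      let _ , ru′ = forward-below ru u<w
          _ , rv′ = forward-below rv v<w
          p , path , below = eraseLoops (_< w) u<w
            (reverse (AdjWithin-sym (_< w)) ru′ ◅◅ rv′)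
      in acyclic (closedPath⇒Cycle p path u≢v
           (All.map (λ x<w w≡x → <-irrefl (sym w≡x) x<w) below) uw vw)

X-entry : ∀ {N} (u : Fin (suc N)) (r : Fin N) →
          X u r ≡ (if does (suc r ≟ u) then 1ℤ else 0ℤ)
X-entry zero    r = refl
X-entry (suc _) r = refl

telescope : ∀ a b c → (a ℤ.- b) ℤ.+ (c ℤ.- a) ≡ c ℤ.- b
telescope = solve-∀

module _ {N} (G : SimpleGraph (suc N)) (tree : IsTree G)
         (increasing : IncreasingFromRoot G) where

  forwardFromRoot : ∀ v → Star (ForwardAdjacent G) zero v
  forwardFromRoot v with proj₁ tree zero v
  ... | w , path = linked⇒forward G w (increasing v w path)

  column-predecessor : ∀ {u k} → ForwardAdjacent G u (suc k) →
    column (forwardAdjacency G) k ≗ X (suc k) ⊖ X u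
  column-predecessor {u} {k} uk r rewrite X-entry u r
    with r ≟ k | suc r ≟ u
  ... | yes refl | yes refl = ⊥-elim (<-irrefl refl (proj₂ uk))
  ... | yes _    | no _     = refl
  ... | no _     | yes refl
    rewrite dec-true (forwardAdjacent? G (suc r) (suc k)) uk = refl
  ... | no _     | no r≢u
    rewrite dec-false (forwardAdjacent? G (suc r) (suc k))
      (λ rk → r≢u (predecessor-unique G (proj₂ tree)
        (forwardFromRoot _) (forwardFromRoot _) rk uk)) = refl

  columnSum-forward : ∀ {u i k j} → i < k → ForwardAdjacent G u (suc k) →
    Star (ForwardAdjacent G) (suc k) (suc j) →
    ∃[ ks ] (Linked _<_ (i ∷ ks ++ j ∷ []) ×
             columnSum (forwardAdjacency G) ks j ≗ X (suc j) ⊖ X u)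
  columnSum-forward i<k uk ε = [] , i<k ∷ [-] , column-predecessor uk
  columnSum-forward {u} {k = k} {j} i<k uk (_◅_ {j = suc _} ky s)
    with columnSum-forward (s<s⁻¹ (proj₂ ky)) ky s
  ... | ks , linked , eq = k ∷ ks , i<k ∷ linked , λ r →
    trans (cong₂ ℤ._+_ (column-predecessor uk r) (eq r))
          (telescope (X (suc k) r) (X u r) (X (suc j) r))

  columnSum-above : ∀ {x i j} → i < j → ¬ ForwardConnected G (suc i) (suc j) →
    x < suc i → Star (ForwardAdjacent G) x (suc j) →
    ∃[ i′ ] ∃[ ks ]
      (i′ < suc i × Linked _<_ (i ∷ ks ++ j ∷ []) ×
       columnSum (forwardAdjacency G) ks j ≗ X (suc j) ⊖ X i′)
  columnSum-above i<j _ x<i ε = ⊥-elim (<-irrefl refl (<-trans x<i (s≤s i<j)))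
  columnSum-above {i = i} i<j ¬fc x<i (_◅_ {j = y} xy s) with <-cmp y (suc i)
  ... | tri< y<i _ _ = columnSum-above i<j ¬fc y<i s
  columnSum-above i<j ¬fc x<i (xy ◅ ε) | tri≈ _ refl _ = ⊥-elim (<-irrefl refl i<j)
  columnSum-above i<j ¬fc x<i (xy ◅ yz ◅ s) | tri≈ _ refl _ =
    ⊥-elim (¬fc (◅⇒TransClosure yz s))
  columnSum-above {x} i<j ¬fc x<i (_◅_ {j = suc k} xy s) | tri> _ _ i<y =
    x , proj₁ rest , x<i , proj₂ rest
    where rest = columnSum-forward (s<s⁻¹ i<y) xy s

corollary4p1 : (N : ℕ) (G : SimpleGraph (suc N)) →
    IsTree G →
    Terminal G zero →
    IncreasingFromRoot G →
    (i j : Fin N) → i < j →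
    ¬ ForwardConnected G (suc i) (suc j) →
    ∃[ i′ ] ∃[ ks ]
    (i′ < suc i × Linked _<_ (i ∷ ks ++ j ∷ []) ×
    columnSum (forwardAdjacency G) ks j ≗ X (suc j) ⊖ X i′)
corollary4p1 N G tree _ increasing i j i<j ¬fc =
  columnSum-above G tree increasing i<j ¬fc (s≤s z≤n)
    (forwardFromRoot G tree increasing (suc j))
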